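{- Let $n\ge2$. Let $A_1=\{12\text{ - }3\}$, $A_2=\{2\text{ - }13,21\text{ - }3\}$, $A_3=\{2\text{ - }31,23\text{ - }1\}$, $A_4=\{32\text{ - }1\}$. For every choice of $p_i\in A_i$ ($i=1,2,3,4$), $|S_n(p_1,p_2,p_3,p_4)|=2$ and $$S_n(p_1,p_2,p_3,p_4)=\{\,1\,n\,2\,(n-1)\ldots,\ \ n\,1\,(n-1)\,2\ldots\,\},$$ where the first permutation is obtained by alternately taking the smallest and the largest of the remaining elements of $\{1,\dots,n\}$, starting with the smallest, and the second by alternately taking the largest and the smallest of the remaining elements, starting with the largest.
   Context: $S_n$ is the set of permutations $\pi=\pi_1\pi_2\cdots\pi_n$ of $\{1,\dots,n\}$ (written in one-line notation). For $abc$ a permutation of $123$, the generalized pattern $a\text{ - }bc$ is contained in $\pi$ if there are indices $i<j$ with $j+1\le n$ such that $\pi_i\pi_j\pi_{j+1}$ is order-isomorphic to $abc$; the generalized pattern $ab\text{ - }c$ is contained in $\pi$ if there are indices $i,k$ with $i+1<k\le n$ such that $\pi_i\pi_{i+1}\pi_k$ is order-isomorphic to $abc$. $\pi$ avoids a pattern if it does not contain it. $S_n(p_1,\dots,p_m)$ is the set of $\pi\in S_n$ avoiding all of $p_1,\dots,p_m$. -}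

module Defs where

open import Data.Fin using (Fin; toℕ)
import Data.Fin as Fin
open import Data.List using (List; []; _∷_; applyUpTo)
open import Data.List.Relation.Binary.Permutation.Propositional using (_↭_)
open import Data.List.Relation.Unary.All using (All)
open import Data.Nat using (ℕ; zero; suc; _+_; _<_)
open import Data.Product using (Σ; ∃-syntax; _×_; proj₁)
open import Data.Vec using (Vec; []; _∷_; lookup; toList)
open import Function.Bundles using (_⇔_; Inverse)
import Relation.Binary.Construct.On as On
open import Relation.Binary.PropositionalEquality using (_≡_; setoid)
open import Relation.Nullary using (¬_)
open import Relation.Unary using (Pred)

-- One-line notation: w lists each of 1, …, n exactly once.
IsPermutation : (n : ℕ) → Pred (Vec ℕ n) _
IsPermutation n w = toList w ↭ applyUpTo suc n

OrderIsomorphic : ∀ {m} → Vec ℕ m → Vec ℕ m → Set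
OrderIsomorphic {m} u v =
  (x y : Fin m) → (lookup u x < lookup u y) ⇔ (lookup v x < lookup v y)

-- a - b · c is the pattern a-bc, and a · b - c is the pattern ab-c: the letters
-- around the dot must be matched by adjacent entries.
infix 5 _-_·_ _·_-_

data Pattern : Set where
  _-_·_ : (a b c : ℕ) → Pattern
  _·_-_ : (a b c : ℕ) → Pattern

Contains : ∀ {n} → Vec ℕ n → Pattern → Set
Contains {n} w (a - b · c) =
  ∃[ i ] ∃[ j ] ∃[ k ] (i Fin.< j) × (toℕ {n} k ≡ suc (toℕ {n} j)) ×
    OrderIsomorphic (lookup w i ∷ lookup w j ∷ lookup w k ∷ []) (a ∷ b ∷ c ∷ [])
Contains {n} w (a · b - c) =
  ∃[ i ] ∃[ j ] ∃[ k ] (toℕ {n} j ≡ suc (toℕ {n} i)) × (j Fin.< k) ×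
    OrderIsomorphic (lookup w i ∷ lookup w j ∷ lookup w k ∷ []) (a ∷ b ∷ c ∷ [])

Avoids : ∀ {n} → Vec ℕ n → Pattern → Set
Avoids w p = ¬ Contains w p

S : (n : ℕ) → List Pattern → Pred (Vec ℕ n) _
S n ps w = IsPermutation n w × All (Avoids w) ps

-- Elements of the subset P are compared by their underlying elements of A only,
-- so that different membership proofs are not counted separately.
HasCardinality : ∀ {a ℓ} {A : Set a} → Pred A ℓ → ℕ → Set _
HasCardinality {A = A} P k =
  Inverse (On.setoid {B = Σ A P} (setoid A) proj₁) (setoid (Fin k))

A₁ A₂ A₃ A₄ : List Pattern
A₁ = (1 · 2 - 3) ∷ []
A₂ = (2 - 1 · 3) ∷ (2 · 1 - 3) ∷ []
A₃ = (2 - 3 · 1) ∷ (2 · 3 - 1) ∷ []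
A₄ = (3 · 2 - 1) ∷ []

-- Alternately take the smallest and the largest remaining element, where the k
-- remaining elements always form an interval a, a + 1, …, a + k ∸ 1.
smallestFirst largestFirst : (a k : ℕ) → Vec ℕ k
smallestFirst a zero    = []
smallestFirst a (suc k) = a ∷ largestFirst (suc a) k
largestFirst  a zero    = []
largestFirst  a (suc k) = a + k ∷ smallestFirst a k

{-# OPTIONS --safe #-}

-- For distinct letters, avoiding 12-3, 21-3, 23-1 and 32-1 says exactly that every
-- letter lies strictly between any two adjacent letters preceding it. Such a word is
-- forced to alternate between the minimum and the maximum of what remains, so it is
-- determined by whether it starts with an ascent or a descent. The patterns 2-13 and
-- 2-31 may replace 21-3 and 23-1: after an occurrence of 21-3 the word passes from
-- below the letter "2" to above it, and the step where it crosses gives a 2-13.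
module Submission where

open import Defs
open import Data.Fin using (Fin; zero; suc; toℕ; inject₁)
import Data.Fin as Fin
import Data.Fin.Induction as Fin
import Data.Fin.Properties as Fin
open import Data.List using (List; []; _∷_; _∷ʳ_; applyUpTo)
import Data.List.Properties as List
open import Data.List.Membership.Propositional using (_∈_)
open import Data.List.Relation.Binary.Permutation.Propositional
  using (_↭_; ↭-refl; ↭-reflexive; ↭-sym; ↭-trans; prep; ↭⇒↭ₛ)
open import Data.List.Relation.Binary.Permutation.Propositional.Properties
  using (All-resp-↭; drop-∷; ∷↭∷ʳ; ↭-singleton-inv)
import Data.List.Relation.Binary.Permutation.Setoid.Properties as Permutationₛ
open import Data.List.Relation.Unary.All using (All; []; _∷_)
import Data.List.Relation.Unary.All.Properties as All
open import Data.List.Relation.Unary.Any using (here; there)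
open import Data.List.Relation.Unary.Unique.Propositional using (Unique; _∷_)
import Data.List.Relation.Unary.Unique.Propositional.Properties as Unique
open import Data.Nat using (ℕ; zero; suc; _+_; _≤_; _<_; _<?_; z≤n; z<s; s≤s; s<s; s≤s⁻¹)
open import Data.Nat.Properties
open import Data.Product using (_×_; _,_; proj₁; proj₂; ∃-syntax)
import Data.Product as Product
open import Data.Sum using (_⊎_; inj₁; inj₂; swap)
import Data.Sum as Sum
open import Data.Vec using (Vec; []; _∷_; lookup; toList)
import Data.Vec.Properties as Vec
import Data.Vec.Relation.Unary.All.Properties as Vec
open import Function.Base using (_∘_)
open import Function.Bundles using (_⇔_; mk⇔; Equivalence)
open import Function.Properties.Equivalence using () renaming (sym to ⇔-sym)
open import Relation.Binary.Definitions using (tri<; tri≈; tri>)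
open import Relation.Binary.PropositionalEquality
  using (_≡_; _≢_; refl; sym; trans; cong; cong₂; subst; setoid; module ≡-Reasoning)
open import Relation.Nullary using (¬_; Dec; yes; no; contradiction)
open import Relation.Nullary.Decidable using (_×-dec_; _⊎-dec_; from-yes; from-no)
open import Relation.Unary using (Pred; Decidable; _≐_; _∪_; ｛_｝)

private
  variable
    m n : ℕ

-- Betweenness of natural numbers

Between : (x y z : ℕ) → Set
Between x y z = (x < z × z < y) ⊎ (y < z × z < x)

between? : ∀ x y z → Dec (Between x y z)
between? x y z = ((x <? z) ×-dec (z <? y)) ⊎-dec ((y <? z) ×-dec (z <? x))

-- Three numbers have at most one middle one, and it cannot be both `z` and `x`.
between-asym : ∀ {x y z} → Between x y z → ¬ Between y z x
between-asym (inj₁ (x<z , z<y)) (inj₁ (y<x , x<z′)) = <-asym y<x (<-trans x<z z<y)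
between-asym (inj₁ (x<z , z<y)) (inj₂ (z<x , x<y))  = <-asym x<z z<x
between-asym (inj₂ (y<z , z<x)) (inj₁ (y<x , x<z))  = <-asym x<z z<x
between-asym (inj₂ (y<z , z<x)) (inj₂ (z<x′ , x<y)) = <-asym x<y (<-trans y<z z<x)

-- Both `z` and `z′` lie on the same side of `x` as `y` does, so `x` cannot separate them.
between-same-side : ∀ {x y z z′} → Between x y z → Between x y z′ → ¬ Between z z′ x
between-same-side (inj₁ (x<z , _))   _                    (inj₁ (z<x , _))  = <-asym x<z z<x
between-same-side _                  (inj₂ (_ , z′<x))    (inj₁ (_ , x<z′)) = <-asym x<z′ z′<x
between-same-side (inj₂ (y<z , z<x)) (inj₁ (x<z′ , z′<y)) (inj₁ _)          =
  <-asym (<-trans y<z z<x) (<-trans x<z′ z′<y)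
between-same-side (inj₂ (_ , z<x))   _                    (inj₂ (_ , x<z))  = <-asym x<z z<x
between-same-side _                  (inj₁ (x<z′ , _))    (inj₂ (z′<x , _)) = <-asym x<z′ z′<x
between-same-side (inj₁ (x<z , z<y)) (inj₂ (y<z′ , z′<x)) (inj₂ _)          =
  <-asym (<-trans x<z z<y) (<-trans y<z′ z′<x)

-- Order isomorphism of three-letter words

SameOrder : (x y a b : ℕ) → Set
SameOrder x y a b = (x < y × a < b) ⊎ (y < x × b < a)

sameOrder⇒⇔ : ∀ {x y a b} → SameOrder x y a b → (x < y) ⇔ (a < b)
sameOrder⇒⇔ (inj₁ (x<y , a<b)) = mk⇔ (λ _ → a<b) (λ _ → x<y)
sameOrder⇒⇔ (inj₂ (y<x , b<a)) =
  mk⇔ (λ x<y → contradiction y<x (<-asym x<y)) (λ a<b → contradiction b<a (<-asym a<b))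

-- Three comparisons settle all nine entries: those below the diagonal come from `swap`, those on it
-- from irreflexivity.
orderIsomorphic : ∀ {x y z a b c} →
  SameOrder x y a b → SameOrder x z a c → SameOrder y z b c →
  OrderIsomorphic (x ∷ y ∷ z ∷ []) (a ∷ b ∷ c ∷ [])
orderIsomorphic {x} {y} {z} {a} {b} {c} xy xz yz = iso
  where
  <-irrefl⇔ : ∀ {m n} → (m < m) ⇔ (n < n)
  <-irrefl⇔ = mk⇔ (λ m<m → contradiction m<m (<-irrefl refl))
                  (λ n<n → contradiction n<n (<-irrefl refl))

  iso : OrderIsomorphic (x ∷ y ∷ z ∷ []) (a ∷ b ∷ c ∷ [])
  iso zero             zero             = <-irrefl⇔
  iso zero             (suc zero)       = sameOrder⇒⇔ xy
  iso zero             (suc (suc zero)) = sameOrder⇒⇔ xz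
  iso (suc zero)       zero             = sameOrder⇒⇔ (swap xy)
  iso (suc zero)       (suc zero)       = <-irrefl⇔
  iso (suc zero)       (suc (suc zero)) = sameOrder⇒⇔ yz
  iso (suc (suc zero)) zero             = sameOrder⇒⇔ (swap xz)
  iso (suc (suc zero)) (suc zero)       = sameOrder⇒⇔ (swap yz)
  iso (suc (suc zero)) (suc (suc zero)) = <-irrefl⇔

between-transport : (u v : Vec ℕ m) → OrderIsomorphic u v → ∀ p q r →
  Between (lookup u p) (lookup u q) (lookup u r) → Between (lookup v p) (lookup v q) (lookup v r)
between-transport u v u≈v p q r =
  Sum.map (Product.map (to p r) (to r q)) (Product.map (to q r) (to r p))
  where to = λ x y → Equivalence.to (u≈v x y)

orderIsomorphic-sym : (u v : Vec ℕ m) → OrderIsomorphic u v → OrderIsomorphic v u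
orderIsomorphic-sym u v u≈v x y = ⇔-sym (u≈v x y)

-- Nested words

Nested : Vec ℕ n → Set
Nested {n} w = (i j k : Fin n) → toℕ j ≡ suc (toℕ i) → j Fin.< k →
  Between (lookup w i) (lookup w j) (lookup w k)

nested-tail : ∀ {x} (v : Vec ℕ n) → Nested (x ∷ v) → Nested v
nested-tail v nested i j k j≡1+i j<k = nested (suc i) (suc j) (suc k) (cong suc j≡1+i) (s<s j<k)

nested-∷ : ∀ {x y} (v : Vec ℕ n) → (∀ k → Between x y (lookup v k)) →
  Nested (y ∷ v) → Nested (x ∷ y ∷ v)
nested-∷ v bet nested zero    (suc zero) (suc (suc k)) _     _         = bet k
nested-∷ v bet nested zero    (suc zero) (suc zero)    _     (s<s ())
nested-∷ v bet nested (suc i) (suc j)    (suc k)       j≡1+i (s<s j<k) =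
  nested i j k (suc-injective j≡1+i) j<k

-- Dropping letters reduces to `i` being the first position. Every letter from the third on lies
-- between the first two. So either `j` is the second position and the letter at `k` is already the
-- middle one of the three, or the letters at `j` and `k` both lie on the same side of the first.
nested⇒¬between : (w : Vec ℕ n) → Nested w → ∀ i j k → i Fin.< j → j Fin.< k →
  ¬ Between (lookup w j) (lookup w k) (lookup w i)
nested⇒¬between (x ∷ v) nested (suc i) (suc j) (suc k) (s<s i<j) (s<s j<k) =
  nested⇒¬between v (nested-tail v nested) i j k i<j j<k
nested⇒¬between w@(_ ∷ _ ∷ _) nested zero (suc zero) k i<j j<k =
  between-asym {lookup w zero} (nested zero (suc zero) k refl j<k)
nested⇒¬between w@(_ ∷ _ ∷ _) nested zero j@(suc (suc _)) k i<j j<k =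
  between-same-side {lookup w zero} {lookup w (suc zero)}
    (nested zero (suc zero) j refl 1<j) (nested zero (suc zero) k refl (<-trans 1<j j<k))
  where
  1<j : 1 < toℕ j
  1<j = s<s z<s

-- From nestedness to avoidance

nested⇒avoids-ab-c : (w : Vec ℕ n) → Nested w → ∀ {a b c} → ¬ Between a b c → Avoids w (a · b - c)
nested⇒avoids-ab-c w nested {a} {b} {c} ¬bet (i , j , k , j≡1+i , j<k , iso) =
  ¬bet (between-transport (lookup w i ∷ lookup w j ∷ lookup w k ∷ []) (a ∷ b ∷ c ∷ []) iso
    zero (suc zero) (suc (suc zero)) (nested i j k j≡1+i j<k))

nested⇒avoids-a-bc : (w : Vec ℕ n) → Nested w → ∀ {a b c} → Between b c a → Avoids w (a - b · c)
nested⇒avoids-a-bc w nested {a} {b} {c} bet (i , j , k , i<j , k≡1+j , iso) =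
  nested⇒¬between w nested i j k i<j (≤-reflexive (sym k≡1+j))
    (between-transport abc letters (orderIsomorphic-sym letters abc iso)
      (suc zero) (suc (suc zero)) zero bet)
  where
  letters abc : Vec ℕ 3
  letters = lookup w i ∷ lookup w j ∷ lookup w k ∷ []
  abc     = a ∷ b ∷ c ∷ []

-- Each listed pattern of the form `a · b - c` ends in an extreme letter, although nestedness makes
-- the last letter the middle one. Each of the form `a - b · c` starts with the middle letter 2,
-- which `nested⇒¬between` forbids.
nested⇒avoids : (w : Vec ℕ n) → Nested w → ∀ {p₁ p₂ p₃ p₄} →
  p₁ ∈ A₁ → p₂ ∈ A₂ → p₃ ∈ A₃ → p₄ ∈ A₄ → All (Avoids w) (p₁ ∷ p₂ ∷ p₃ ∷ p₄ ∷ [])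
nested⇒avoids w nested {p₂ = p₂} {p₃} (here refl) p₂∈ p₃∈ (here refl) =
  ab-c (from-no (between? 1 2 3)) ∷ avoids₂ p₂∈ ∷ avoids₃ p₃∈ ∷
  ab-c (from-no (between? 3 2 1)) ∷ []
  where
  ab-c : ∀ {a b c} → ¬ Between a b c → Avoids w (a · b - c)
  ab-c = nested⇒avoids-ab-c w nested

  a-bc : ∀ {a b c} → Between b c a → Avoids w (a - b · c)
  a-bc = nested⇒avoids-a-bc w nested

  avoids₂ : p₂ ∈ A₂ → Avoids w p₂
  avoids₂ (here refl)         = a-bc (from-yes (between? 1 3 2))
  avoids₂ (there (here refl)) = ab-c (from-no (between? 2 1 3))

  avoids₃ : p₃ ∈ A₃ → Avoids w p₃
  avoids₃ (here refl)         = a-bc (from-yes (between? 3 1 2))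
  avoids₃ (there (here refl)) = ab-c (from-no (between? 2 3 1))

-- From avoidance to nestedness

Distinct : Vec ℕ n → Set
Distinct {n} w = (i j : Fin n) → i Fin.< j → lookup w i ≢ lookup w j

-- A discrete intermediate value theorem, by induction on `k`: if `Q` holds just before `k`, the
-- crossing is there, and otherwise it is found earlier. The bound on `j′` keeps the crossing to the
-- right of the letter it is later compared with.
crossing-step : ∀ {ℓ} {Q : Pred (Fin n) ℓ} → Decidable Q →
  ∀ {j k} → j Fin.≤ k → Q j → ¬ Q k →
  ∃[ j′ ] ∃[ k′ ] (j Fin.≤ j′) × (toℕ k′ ≡ suc (toℕ j′)) × Q j′ × ¬ Q k′
crossing-step {suc n} {Q = Q} Q? {j} {k} j≤k Qj ¬Qk = Fin.<-weakInduction P base step k j≤k ¬Qk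
  where
  P : Pred (Fin (suc n)) _
  P k = j Fin.≤ k → ¬ Q k →
    ∃[ j′ ] ∃[ k′ ] (j Fin.≤ j′) × (toℕ k′ ≡ suc (toℕ j′)) × Q j′ × ¬ Q k′

  base : P zero
  base j≤0 ¬Q0 = contradiction (subst Q (Fin.≤-antisym j≤0 z≤n) Qj) ¬Q0

  step : ∀ i → P (inject₁ i) → P (suc i)
  step i ih j≤1+i ¬Q1+i with Fin.<-cmp j (suc i)
  ... | tri≈ _ refl _ = contradiction Qj ¬Q1+i
  ... | tri> _ _ 1+i<j = contradiction j≤1+i (<⇒≱ 1+i<j)
  ... | tri< j<1+i _ _ with Q? (inject₁ i)
  ...   | yes Qi = inject₁ i , suc i , j≤i , cong suc (sym (Fin.toℕ-inject₁ i)) , Qi , ¬Q1+i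
    where
    j≤i : j Fin.≤ inject₁ i
    j≤i = subst (toℕ j ≤_) (sym (Fin.toℕ-inject₁ i)) (s≤s⁻¹ j<1+i)
  ...   | no ¬Qi = ih (subst (toℕ j ≤_) (sym (Fin.toℕ-inject₁ i)) (s≤s⁻¹ j<1+i)) ¬Qi

contains-21-3⇒contains-2-13 : (w : Vec ℕ n) → Distinct w →
  Contains w (2 · 1 - 3) → Contains w (2 - 1 · 3)
contains-21-3⇒contains-2-13 w distinct (i , j , k , j≡1+i , j<k , iso)
  with crossing-step (λ x → lookup w x <? lookup w i) (<⇒≤ j<k)
         (Equivalence.from (iso (suc zero) zero) (s<s z<s))
         (<-asym (Equivalence.from (iso zero (suc (suc zero))) (s<s (s<s z<s))))
... | j′ , k′ , j≤j′ , k′≡1+j′ , lo , ¬hi =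
  i , j′ , k′ , i<j′ , k′≡1+j′ ,
  orderIsomorphic (inj₂ (lo , s<s z<s)) (inj₁ (hi , s<s (s<s z<s)))
    (inj₁ (<-trans lo hi , s<s z<s))
  where
  i<j′ : i Fin.< j′
  i<j′ = ≤-trans (≤-reflexive (sym j≡1+i)) j≤j′

  -- Failure of the predicate only gives a weak inequality; it is strict because `k′` is a later
  -- position than `i` and letters are distinct.
  hi : lookup w i < lookup w k′
  hi = ≤∧≢⇒< (≮⇒≥ ¬hi) (distinct i k′ (<-trans i<j′ (≤-reflexive (sym k′≡1+j′))))

-- The order-reversed argument: the word passes from above the letter "2" to below it, and the
-- crossing step supplies the adjacent "31".
contains-23-1⇒contains-2-31 : (w : Vec ℕ n) → Distinct w →
  Contains w (2 · 3 - 1) → Contains w (2 - 3 · 1)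
contains-23-1⇒contains-2-31 w distinct (i , j , k , j≡1+i , j<k , iso)
  with crossing-step (λ x → lookup w i <? lookup w x) (<⇒≤ j<k)
         (Equivalence.from (iso zero (suc zero)) (s<s (s<s z<s)))
         (<-asym (Equivalence.from (iso (suc (suc zero)) zero) (s<s z<s)))
... | j′ , k′ , j≤j′ , k′≡1+j′ , hi , ¬lo =
  i , j′ , k′ , i<j′ , k′≡1+j′ ,
  orderIsomorphic (inj₁ (hi , s<s (s<s z<s))) (inj₂ (lo , s<s z<s))
    (inj₂ (<-trans lo hi , s<s z<s))
  where
  i<j′ : i Fin.< j′
  i<j′ = ≤-trans (≤-reflexive (sym j≡1+i)) j≤j′

  lo : lookup w k′ < lookup w i
  lo = ≤∧≢⇒< (≮⇒≥ ¬lo) (distinct i k′ (<-trans i<j′ (≤-reflexive (sym k′≡1+j′))) ∘ sym)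

-- Three distinct letters have six possible orders. Four are the forbidden patterns; in the other
-- two, 13-2 and 31-2, the last letter is the middle one.
avoids⇒nested : (w : Vec ℕ n) → Distinct w →
  Avoids w (1 · 2 - 3) → Avoids w (2 · 1 - 3) → Avoids w (2 · 3 - 1) → Avoids w (3 · 2 - 1) →
  Nested w
avoids⇒nested w distinct ¬12-3 ¬21-3 ¬23-1 ¬32-1 i j k j≡1+i j<k
  with i<j ← ≤-reflexive (sym j≡1+i)
  with <-cmp (lookup w i) (lookup w j) | <-cmp (lookup w i) (lookup w k)
     | <-cmp (lookup w j) (lookup w k)
... | tri≈ _ i≡j _ | _            | _            = contradiction i≡j (distinct i j i<j)
... | _            | tri≈ _ i≡k _ | _            =
  contradiction i≡k (distinct i k (<-trans i<j j<k))
... | _            | _            | tri≈ _ j≡k _ = contradiction j≡k (distinct j k j<k)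
... | tri< x<y _ _ | tri< x<z _ _ | tri> _ _ z<y = inj₁ (x<z , z<y)
... | tri> _ _ y<x | tri> _ _ z<x | tri< y<z _ _ = inj₂ (y<z , z<x)
-- Of the eight combinations of strict comparisons, this one and the next are cyclic and contradict
-- transitivity.
... | tri< x<y _ _ | tri> _ _ z<x | tri< y<z _ _ = contradiction (<-trans x<y y<z) (<-asym z<x)
... | tri> _ _ y<x | tri< x<z _ _ | tri> _ _ z<y = contradiction (<-trans y<x x<z) (<-asym z<y)
... | tri< x<y _ _ | tri< x<z _ _ | tri< y<z _ _ = contradiction
  (i , j , k , j≡1+i , j<k , orderIsomorphic
    (inj₁ (x<y , s<s z<s)) (inj₁ (x<z , s<s z<s)) (inj₁ (y<z , s<s (s<s z<s)))) ¬12-3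
... | tri> _ _ y<x | tri< x<z _ _ | tri< y<z _ _ = contradiction
  (i , j , k , j≡1+i , j<k , orderIsomorphic
    (inj₂ (y<x , s<s z<s)) (inj₁ (x<z , s<s (s<s z<s))) (inj₁ (y<z , s<s z<s))) ¬21-3
... | tri< x<y _ _ | tri> _ _ z<x | tri> _ _ z<y = contradiction
  (i , j , k , j≡1+i , j<k , orderIsomorphic
    (inj₁ (x<y , s<s (s<s z<s))) (inj₂ (z<x , s<s z<s)) (inj₂ (z<y , s<s z<s))) ¬23-1
... | tri> _ _ y<x | tri> _ _ z<x | tri> _ _ z<y = contradiction
  (i , j , k , j≡1+i , j<k , orderIsomorphic
    (inj₂ (y<x , s<s (s<s z<s))) (inj₂ (z<x , s<s z<s)) (inj₂ (z<y , s<s z<s))) ¬32-1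

allAvoids⇒nested : (w : Vec ℕ n) → Distinct w → ∀ {p₁ p₂ p₃ p₄} →
  p₁ ∈ A₁ → p₂ ∈ A₂ → p₃ ∈ A₃ → p₄ ∈ A₄ → All (Avoids w) (p₁ ∷ p₂ ∷ p₃ ∷ p₄ ∷ []) → Nested w
allAvoids⇒nested w distinct {p₂ = p₂} {p₃} (here refl) p₂∈ p₃∈ (here refl)
  (¬p₁ ∷ ¬p₂ ∷ ¬p₃ ∷ ¬p₄ ∷ []) =
  avoids⇒nested w distinct ¬p₁ (avoids-21-3 p₂∈ ¬p₂) (avoids-23-1 p₃∈ ¬p₃) ¬p₄
  where
  avoids-21-3 : p₂ ∈ A₂ → Avoids w p₂ → Avoids w (2 · 1 - 3)
  avoids-21-3 (here refl)         ¬p = ¬p ∘ contains-21-3⇒contains-2-13 w distinct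
  avoids-21-3 (there (here refl)) ¬p = ¬p

  avoids-23-1 : p₃ ∈ A₃ → Avoids w p₃ → Avoids w (2 · 3 - 1)
  avoids-23-1 (here refl)         ¬p = ¬p ∘ contains-23-1⇒contains-2-31 w distinct
  avoids-23-1 (there (here refl)) ¬p = ¬p

-- Permutations of an interval

range : (a k : ℕ) → List ℕ
range a k = applyUpTo (a +_) k

-- Unfolding the head would leave the generator `λ i → a + suc i`, equal to `suc a +_` only
-- pointwise. Splitting off the last element instead keeps the generators fixed, so that the
-- induction closes.
range-∷ : ∀ a k → range a (suc k) ≡ a ∷ range (suc a) k
range-∷ a zero    = cong (_∷ []) (+-identityʳ a)
range-∷ a (suc k) = begin
  range a (suc (suc k))                      ≡⟨ List.applyUpTo-∷ʳ (a +_) (suc k) ⟨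
  range a (suc k) ∷ʳ (a + suc k)             ≡⟨ cong₂ _∷ʳ_ (range-∷ a k) (+-suc a k) ⟩
  a ∷ (range (suc a) k ∷ʳ (suc a + k))       ≡⟨ cong (a ∷_) (List.applyUpTo-∷ʳ (suc a +_) k) ⟩
  a ∷ range (suc a) (suc k)                  ∎
  where open ≡-Reasoning

range↭min : ∀ a k → range a (suc k) ↭ a ∷ range (suc a) k
range↭min a k = ↭-reflexive (range-∷ a k)

range↭max : ∀ a k → range a (suc k) ↭ (a + k) ∷ range a k
range↭max a k = ↭-trans (↭-reflexive (sym (List.applyUpTo-∷ʳ (a +_) k)))
  (↭-sym (∷↭∷ʳ (a + k) (range a k)))

range-bounds : ∀ a k → All (λ x → a ≤ x × x < a + k) (range a k)
range-bounds a k = All.applyUpTo⁺₁ (a +_) k (λ i<k → m≤m+n a _ , +-monoʳ-< a i<k)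

↭range⇒bounds : ∀ {a k} (w : Vec ℕ m) → toList w ↭ range a k →
  ∀ i → a ≤ lookup w i × lookup w i < a + k
↭range⇒bounds {a = a} {k} w w↭ =
  Vec.lookup⁺ (Vec.toList⁻ (All-resp-↭ (↭-sym w↭) (range-bounds a k)))

unique⇒distinct : (w : Vec ℕ n) → Unique (toList w) → Distinct w
unique⇒distinct (x ∷ v) (x∉v ∷ _) zero    (suc j) _         = Vec.lookup⁺ (Vec.toList⁻ x∉v) j
unique⇒distinct (x ∷ v) (_ ∷ v!)  (suc i) (suc j) (s<s i<j) = unique⇒distinct v v! i j i<j

↭range⇒distinct : ∀ {a k} (w : Vec ℕ n) → toList w ↭ range a k → Distinct w
↭range⇒distinct {a = a} {k} w w↭ = unique⇒distinct w
  (Permutationₛ.Unique-resp-↭ (setoid ℕ) (↭⇒↭ₛ (↭-sym w↭))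
    (Unique.applyUpTo⁺₁ (a +_) k (λ i<j _ → <⇒≢ i<j ∘ +-cancelˡ-≡ a _ _)))

-- The two alternating words

mutual
  smallestFirst↭range : ∀ a k → toList (smallestFirst a k) ↭ range a k
  smallestFirst↭range a zero    = ↭-refl
  smallestFirst↭range a (suc k) =
    ↭-trans (prep a (largestFirst↭range (suc a) k)) (↭-sym (range↭min a k))

  largestFirst↭range : ∀ a k → toList (largestFirst a k) ↭ range a k
  largestFirst↭range a zero    = ↭-refl
  largestFirst↭range a (suc k) =
    ↭-trans (prep (a + k) (smallestFirst↭range a k)) (↭-sym (range↭max a k))

mutual
  -- The first two letters are the minimum and the maximum of the interval, and the rest permutes
  -- the open interval between them; its range bounds are then exactly the betweenness required.
  smallestFirst-nested : ∀ a k → Nested (smallestFirst a k)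
  smallestFirst-nested a zero          ()
  smallestFirst-nested a (suc zero)    zero zero zero ()
  smallestFirst-nested a (suc (suc k)) =
    nested-∷ (smallestFirst (suc a) k)
      (λ i → inj₁ (↭range⇒bounds (smallestFirst (suc a) k) (smallestFirst↭range (suc a) k) i))
      (largestFirst-nested (suc a) (suc k))

  largestFirst-nested : ∀ a k → Nested (largestFirst a k)
  largestFirst-nested a zero          ()
  largestFirst-nested a (suc zero)    zero zero zero ()
  largestFirst-nested a (suc (suc k)) =
    nested-∷ (largestFirst (suc a) k)
      (λ i → let lo , hi = ↭range⇒bounds v (largestFirst↭range (suc a) k) i
             in inj₂ (lo , subst (lookup v i <_) (sym (+-suc a k)) hi))
      (smallestFirst-nested a (suc k))
    where v = largestFirst (suc a) k

-- Uniqueness of nested permutations of an interval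

minimal-head : ∀ {a k x xs} → x ∷ xs ↭ range a (suc k) → All (x ≤_) xs →
  x ≡ a × xs ↭ range (suc a) k
minimal-head {a} {k} {x} {xs} x∷xs↭ x≤ = x≡a , drop-∷ (subst (λ y → y ∷ xs ↭ _) x≡a ↭a∷)
  where
  ↭a∷ : x ∷ xs ↭ a ∷ range (suc a) k
  ↭a∷ = ↭-trans x∷xs↭ (range↭min a k)

  x≡a : x ≡ a
  -- The letter `a` occurs in the word, so the lower bound `x` is at most `a`; conversely all
  -- letters are at least `a`.
  x≡a with All-resp-↭ ↭a∷ (≤-refl ∷ x≤) | All-resp-↭ (↭-sym x∷xs↭) (range-bounds a (suc k))
  ... | x≤a ∷ _ | (a≤x , _) ∷ _ = ≤-antisym x≤a a≤x

maximal-head : ∀ {a k x xs} → x ∷ xs ↭ range a (suc k) → All (_≤ x) xs →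
  x ≡ a + k × xs ↭ range a k
maximal-head {a} {k} {x} {xs} x∷xs↭ ≤x = x≡a+k , drop-∷ (subst (λ y → y ∷ xs ↭ _) x≡a+k ↭a+k∷)
  where
  ↭a+k∷ : x ∷ xs ↭ (a + k) ∷ range a k
  ↭a+k∷ = ↭-trans x∷xs↭ (range↭max a k)

  x≡a+k : x ≡ a + k
  x≡a+k with All-resp-↭ ↭a+k∷ (≤-refl ∷ ≤x) | All-resp-↭ (↭-sym x∷xs↭) (range-bounds a (suc k))
  ... | a+k≤x ∷ _ | (_ , x<a+1+k) ∷ _ =
    ≤-antisym (s≤s⁻¹ (subst (x <_) (+-suc a k) x<a+1+k)) a+k≤x

between-ascent : ∀ {x y z} → x < y → Between x y z → x < z × z < y
between-ascent x<y (inj₁ bounds)      = bounds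
between-ascent x<y (inj₂ (y<z , z<x)) = contradiction x<y (<-asym (<-trans y<z z<x))

between-descent : ∀ {x y z} → y < x → Between x y z → y < z × z < x
between-descent y<x = between-ascent y<x ∘ swap

nested-head : ∀ {x y} (v : Vec ℕ n) → Nested (x ∷ y ∷ v) → ∀ k → Between x y (lookup v k)
nested-head v nested k = nested zero (suc zero) (suc (suc k)) refl (s<s z<s)

mutual
  -- After an ascent all later letters lie above `x`, which is therefore the minimum, and below `y`,
  -- so the next step is a descent. Removing `x` leaves the mirrored situation on a shorter
  -- interval.
  ascent⇒smallestFirst : ∀ a x y (v : Vec ℕ n) → toList (x ∷ y ∷ v) ↭ range a (suc (suc n)) →
    Nested (x ∷ y ∷ v) → x < y → x ∷ y ∷ v ≡ smallestFirst a (suc (suc n))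
  ascent⇒smallestFirst a x y v w↭ nested x<y
    with minimal-head w↭ (<⇒≤ x<y ∷ Vec.toList⁺ (Vec.lookup⁻ (λ k →
           <⇒≤ (proj₁ (between-ascent x<y (nested-head v nested k))))))
  ascent⇒smallestFirst a x y [] w↭ nested x<y | x≡a , yv↭ =
    cong₂ (λ x y → x ∷ y ∷ []) x≡a (List.∷-injectiveˡ (↭-singleton-inv yv↭))
  ascent⇒smallestFirst a x y v@(z ∷ v′) w↭ nested x<y | x≡a , yv↭ =
    cong₂ _∷_ x≡a (descent⇒largestFirst (suc a) y z v′ yv↭ (nested-tail (y ∷ v) nested)
      (proj₂ (between-ascent x<y (nested-head v nested zero))))

  descent⇒largestFirst : ∀ a x y (v : Vec ℕ n) → toList (x ∷ y ∷ v) ↭ range a (suc (suc n)) →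
    Nested (x ∷ y ∷ v) → y < x → x ∷ y ∷ v ≡ largestFirst a (suc (suc n))
  descent⇒largestFirst a x y v w↭ nested y<x
    with maximal-head w↭ (<⇒≤ y<x ∷ Vec.toList⁺ (Vec.lookup⁻ (λ k →
           <⇒≤ (proj₂ (between-descent y<x (nested-head v nested k))))))
  descent⇒largestFirst a x y [] w↭ nested y<x | x≡max , yv↭ =
    cong₂ (λ x y → x ∷ y ∷ []) x≡max
      -- The one-element range lists `a + 0`, whereas `smallestFirst a 1` consists of `a` itself.
      (trans (List.∷-injectiveˡ (↭-singleton-inv yv↭)) (+-identityʳ a))
  descent⇒largestFirst a x y v@(z ∷ v′) w↭ nested y<x | x≡max , yv↭ =
    cong₂ _∷_ x≡max (ascent⇒smallestFirst a y z v′ yv↭ (nested-tail (y ∷ v) nested)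
      (proj₁ (between-descent y<x (nested-head v nested zero))))

nested⇒alternating : ∀ a (w : Vec ℕ (suc (suc n))) → toList w ↭ range a (suc (suc n)) → Nested w →
  (｛ smallestFirst a (suc (suc n)) ｝ ∪ ｛ largestFirst a (suc (suc n)) ｝) w
nested⇒alternating a (x ∷ y ∷ v) w↭ nested with <-cmp x y
... | tri< x<y _ _ = inj₁ (sym (ascent⇒smallestFirst a x y v w↭ nested x<y))
... | tri≈ _ x≡y _ = contradiction x≡y (↭range⇒distinct {a = a} (x ∷ y ∷ v) w↭ zero (suc zero) z<s)
... | tri> _ _ y<x = inj₂ (sym (descent⇒largestFirst a x y v w↭ nested y<x))

-- Sets with two elements

pair-cardinality : ∀ {a ℓ} {A : Set a} {P : Pred A ℓ} {u v : A} →
  u ≢ v → P ≐ (｛ u ｝ ∪ ｛ v ｝) → HasCardinality P 2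
pair-cardinality {A = A} {P} {u} {v} u≢v (P⊆ , ⊆P) = record
  { to        = λ (_ , Px) → index (P⊆ Px)
  ; from      = λ i → element i , ⊆P (element∈ i)
  ; to-cong   = λ { {_ , Px} {_ , Py} x≡y → index-cong (P⊆ Px) (P⊆ Py) x≡y }
  ; from-cong = cong element
  ; inverse   = (λ { {i} {_ , Px} x≡ → trans (index-cong (P⊆ Px) (element∈ i) x≡) (index-element i) })
              , (λ { {_ , Px} refl → element-index (P⊆ Px) })
  }
  where
  index : ∀ {x} → (｛ u ｝ ∪ ｛ v ｝) x → Fin 2
  index (inj₁ _) = zero
  index (inj₂ _) = suc zero

  element : Fin 2 → A
  element zero       = u
  element (suc zero) = v

  element∈ : ∀ i → (｛ u ｝ ∪ ｛ v ｝) (element i)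
  element∈ zero       = inj₁ refl
  element∈ (suc zero) = inj₂ refl

  index-element : ∀ i → index (element∈ i) ≡ i
  index-element zero       = refl
  index-element (suc zero) = refl

  element-index : ∀ {x} (x∈ : (｛ u ｝ ∪ ｛ v ｝) x) → element (index x∈) ≡ x
  element-index (inj₁ u≡x) = u≡x
  element-index (inj₂ v≡x) = v≡x

  -- The index is read off a membership proof, not off the element. Two proofs for the same element
  -- still agree on it, since differing sides would identify `u` with `v`.
  index-cong : ∀ {x y} (x∈ : (｛ u ｝ ∪ ｛ v ｝) x) (y∈ : (｛ u ｝ ∪ ｛ v ｝) y) →
    x ≡ y → index x∈ ≡ index y∈
  index-cong (inj₁ _)   (inj₁ _)   _    = refl
  index-cong (inj₂ _)   (inj₂ _)   _    = refl
  index-cong (inj₁ u≡x) (inj₂ v≡x) refl = contradiction (trans u≡x (sym v≡x)) u≢v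
  index-cong (inj₂ v≡x) (inj₁ u≡x) refl = contradiction (trans u≡x (sym v≡x)) u≢v

proposition2p8 : (n : ℕ) → 2 ≤ n →
    (p₁ p₂ p₃ p₄ : Pattern) → p₁ ∈ A₁ → p₂ ∈ A₂ → p₃ ∈ A₃ → p₄ ∈ A₄ →
    HasCardinality (S n (p₁ ∷ p₂ ∷ p₃ ∷ p₄ ∷ [])) 2 ×
    (S n (p₁ ∷ p₂ ∷ p₃ ∷ p₄ ∷ []) ≐ (｛ smallestFirst 1 n ｝ ∪ ｛ largestFirst 1 n ｝))
proposition2p8 n@(suc (suc k)) (s≤s (s≤s _)) p₁ p₂ p₃ p₄ p₁∈ p₂∈ p₃∈ p₄∈ =
  pair-cardinality smallest≢largest S≐ , S≐
  where
  smallest≢largest : smallestFirst 1 n ≢ largestFirst 1 n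
  -- The first letters are 1 and `n`, which differ because `n` is at least 2.
  smallest≢largest eq with () ← Vec.∷-injectiveˡ eq

  S≐ : S n (p₁ ∷ p₂ ∷ p₃ ∷ p₄ ∷ []) ≐ (｛ smallestFirst 1 n ｝ ∪ ｛ largestFirst 1 n ｝)
  -- `range 1 n` unfolds to `applyUpTo suc n`, so `w↭` directly serves as a permutation of the
  -- interval starting at 1.
  S≐ = (λ {w} (w↭ , avoids) → nested⇒alternating 1 w w↭
          (allAvoids⇒nested w (↭range⇒distinct {a = 1} w w↭) p₁∈ p₂∈ p₃∈ p₄∈ avoids))
     , λ { (inj₁ refl) → smallestFirst↭range 1 n ,
             nested⇒avoids (smallestFirst 1 n) (smallestFirst-nested 1 n) p₁∈ p₂∈ p₃∈ p₄∈
         ; (inj₂ refl) → largestFirst↭range 1 n ,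
             nested⇒avoids (largestFirst 1 n) (largestFirst-nested 1 n) p₁∈ p₂∈ p₃∈ p₄∈ }
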